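{- Every right-angled Coxeter group (that is, every Coxeter group with $m(i,i')\in\{2,\infty\}$ for all distinct $i,i'\in I$) is superfuturistic.
   Context: Let $(W,S)$ be a Coxeter system with $S=\{s_i:i\in I\}$, $I$ a finite index set; $m(i,i')$ is the order of $s_is_{i'}$. The root space is $V=\mathbb R^I$ with standard basis the simple roots $\{\alpha_i:i\in I\}$ and symmetric bilinear form $B(\alpha_i,\alpha_{i'})=-\cos(\pi/m(i,i'))$ (and $-1$ if $m(i,i')=\infty$). $W$ acts on $V$ by $s_i\beta=\beta-2B(\beta,\alpha_i)\alpha_i$. The root system is $\Phi=\{w\alpha_i:w\in W,i\in I\}=\Phi^+\sqcup\Phi^-$, where $\Phi^+$ are the roots that are nonnegative combinations of simple roots and $\Phi^-=-\Phi^+$. For $\beta\in\Phi$ the half-space $H_\beta^+$ is $\{w\in W:w\beta\in\Phi^+\}$. A subset of $W$ is convex if it is an intersection of half-spaces (the empty intersection being $W$). For a nonempty convex set $\mathscr L\subseteq W$ let $\mathrm R(\mathscr L)=\{\beta\in\Phi:\mathscr L\subseteq H_\beta^+\}$. For $i\in I$, the toggle $\tau_i\colon W\to W$ is defined by $\tau_i(u)=u$ if $u^{ -1}\alpha_i\in\mathrm R(\mathscr L)$ and $\tau_i(u)=s_iu$ otherwise. A Coxeter element is a product $c=s_{i_n}\cdots s_{i_1}$ where $i_1,\ldots,i_n$ is an ordering of $I$ (each element once); $\mathrm{Pro}_c=\tau_{i_n}\cdots\tau_{i_1}$ (composition), which depends only on $c$ and $\mathscr L$. The set $\mathscr L$ is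 superheavy with respect to $c$ if for every $u\in W$ there is an integer $K\ge 0$ with $\mathrm{Pro}_c^K(u)\in\mathscr L$. The Coxeter group $W$ is superfuturistic if every nonempty convex subset of $W$ is superheavy with respect to every Coxeter element of $W$. -}

module Defs where

open import Algebra.Bundles using (Group)
import Algebra.Properties.Semiring.Sum as Sum
open import Axiom.ExcludedMiddle using (ExcludedMiddle)
open import Data.Bool.Base using (if_then_else_)
open import Data.Fin.Base using (Fin; zero; suc)
open import Data.Fin.Properties using (_≟_)
open import Data.Integer.Base as ℤ
  using (ℤ; +_; _+_; _-_; -_; _*_; 0ℤ; 1ℤ; -1ℤ)
import Data.Integer.Properties as ℤₚ
open import Data.Integer.Tactic.RingSolver using (solve-∀)
open import Data.List.Base
  using (List; []; _∷_; _++_; foldl; foldr; reverse; concat; replicate; allFin)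
open import Data.List.Properties
  using (++-assoc; ++-identityʳ; foldr-++; unfold-reverse; reverse-++)
open import Data.List.Relation.Binary.Permutation.Propositional using (_↭_)
open import Data.Maybe.Base using (Maybe; just; nothing)
open import Data.Maybe.Properties using (just-injective)
open import Data.Nat.Base as ℕ using (ℕ)
open import Data.Product.Base using (_×_; _,_; ∃-syntax)
open import Data.Sum.Base using (_⊎_; inj₁; inj₂)
open import Data.Vec.Base as Vec using (Vec; lookup; tabulate; zipWith)
open import Data.Vec.Properties
  using (lookup-zipWith; lookup-map; lookup∘tabulate; tabulate∘lookup; tabulate-cong)
import Function.Endo.Propositional as Endo
open import Level using (0ℓ)
open import Relation.Binary.PropositionalEquality
  using (_≡_; _≢_; refl; sym; trans; cong; cong₂; subst; module ≡-Reasoning)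
open import Relation.Nullary using (yes; no; does; contradiction)
open import Relation.Unary using (Pred; _∈_; _⊆_; _≐_; Satisfiable)

-- `nothing` is the value ∞.
ℕ∞ : Set
ℕ∞ = Maybe ℕ

pattern ∞ = nothing

record CoxeterMatrix (n : ℕ) : Set where
  field
    m        : Fin n → Fin n → ℕ∞
    diagonal : ∀ i → m i i ≡ just 1
    off-diag : ∀ {i j k} → i ≢ j → m i j ≡ just k → 2 ℕ.≤ k
    symm     : ∀ i j → m i j ≡ m j i

RightAngled : ∀ {n} → CoxeterMatrix n → Set
RightAngled M = ∀ {i j} → i ≢ j → (m i j ≡ just 2) ⊎ (m i j ≡ ∞)
  where open CoxeterMatrix M

------------------------------------------------------------------------
-- The Coxeter group, as the group presented by the generators sᵢ and the
-- relations (sᵢ sⱼ)^m(i,j) = 1 for m(i,j) < ∞.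

module Presentation {n : ℕ} (M : CoxeterMatrix n) where

  open CoxeterMatrix M

  Word : Set
  Word = List (Fin n)

  infix 4 _≈_

  data _≈_ : Word → Word → Set where
    ≈-refl   : ∀ {u} → u ≈ u
    ≈-sym    : ∀ {u v} → u ≈ v → v ≈ u
    ≈-trans  : ∀ {u v w} → u ≈ v → v ≈ w → u ≈ w
    ++-cong  : ∀ {u u′ v v′} → u ≈ u′ → v ≈ v′ → u ++ v ≈ u′ ++ v′
    relation : ∀ i j {k} → m i j ≡ just k → concat (replicate k (i ∷ j ∷ [])) ≈ []

  private
    ≡⇒≈ : ∀ {u v} → u ≡ v → u ≈ v
    ≡⇒≈ refl = ≈-refl

    inverseʳ : ∀ u → u ++ reverse u ≈ []
    inverseʳ []      = ≈-refl
    inverseʳ (i ∷ u) =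
      ≈-trans (≡⇒≈ (cong (λ v → i ∷ u ++ v) (unfold-reverse i u)))
      (≈-trans (≡⇒≈ (cong (i ∷_) (sym (++-assoc u (reverse u) (i ∷ [])))))
      (≈-trans (++-cong (≈-refl {i ∷ []}) (++-cong (inverseʳ u) (≈-refl {i ∷ []})))
               (relation i i (diagonal i))))

    inverseˡ : ∀ u → reverse u ++ u ≈ []
    inverseˡ []      = ≈-refl
    inverseˡ (i ∷ u) =
      ≈-trans (≡⇒≈ (trans (cong (_++ i ∷ u) (unfold-reverse i u))
                          (++-assoc (reverse u) (i ∷ []) (i ∷ u))))
      (≈-trans (++-cong (≈-refl {reverse u})
                        (++-cong (relation i i (diagonal i)) (≈-refl {u})))
               (inverseˡ u))

    reverse-cong : ∀ {u v} → u ≈ v → reverse u ≈ reverse v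
    reverse-cong {u} {v} u≈v =
      ≈-trans (≡⇒≈ (sym (++-identityʳ (reverse u))))
      (≈-trans (++-cong (≈-refl {reverse u}) (≈-sym (inverseʳ v)))
      (≈-trans (≡⇒≈ (sym (++-assoc (reverse u) v (reverse v))))
      (++-cong (≈-trans (++-cong (≈-refl {reverse u}) (≈-sym u≈v)) (inverseˡ u))
               (≈-refl {reverse v}))))

  group : Group 0ℓ 0ℓ
  group = record
    { Carrier = Word
    ; _≈_     = _≈_
    ; _∙_     = _++_
    ; ε       = []
    ; _⁻¹     = reverse
    ; isGroup = record
      { isMonoid = record
        { isSemigroup = record
          { isMagma = record
            { isEquivalence = record { refl = ≈-refl ; sym = ≈-sym ; trans = ≈-trans }
            ; ∙-cong        = ++-cong
            }
          ; assoc = λ u v w → ≡⇒≈ (++-assoc u v w)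
          }
        ; identity = (λ _ → ≈-refl) , (λ u → ≡⇒≈ (++-identityʳ u))
        }
      ; inverse = inverseˡ , inverseʳ
      ; ⁻¹-cong = reverse-cong
      }
    }

module CoxeterGroup {n : ℕ} (M : CoxeterMatrix n) where

  open Group (Presentation.group M) public
    using (_≈_; _∙_; ε; _⁻¹) renaming (Carrier to W)

  s : Fin n → W
  s i = i ∷ []

------------------------------------------------------------------------
-- In the right-angled case every B(αᵢ, αⱼ) is an integer, so W preserves
-- the lattice spanned by the simple roots and all roots lie in it; this
-- lattice takes the place of the root space ℝ^I.

module RootSystem {n : ℕ} (M : CoxeterMatrix n) (ra : RightAngled M) where

  open CoxeterGroup M
  open Sum ℤₚ.+-*-semiring using (sum-syntax)

  V : Set
  V = Vec ℤ n

  α : Fin n → V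
  α i = tabulate (λ j → if does (i ≟ j) then 1ℤ else 0ℤ)

  -- - cos (π / m(i,j)) for m(i,j) = 1, 2, and its limit -1 for m(i,j) = ∞.
  gram : Fin n → Fin n → ℤ
  gram i j with i ≟ j
  ... | yes _  = 1ℤ
  ... | no i≢j with ra i≢j
  ...   | inj₁ _ = 0ℤ
  ...   | inj₂ _ = -1ℤ

  B : V → V → ℤ
  B β γ = ∑[ j < n ] ∑[ k < n ] (lookup β j * lookup γ k * gram j k)

  reflect : Fin n → V → V
  reflect i β = zipWith _-_ β (Vec.map ((+ 2 * B β (α i)) *_) (α i))

  infixr 7 _·_

  _·_ : W → V → V
  w · β = foldr reflect β w

  Φ : Pred V 0ℓ
  Φ β = ∃[ w ] ∃[ i ] β ≡ w · α i

  Φ⁺ : Pred V 0ℓ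
  Φ⁺ β = β ∈ Φ × (∀ j → 0ℤ ℤ.≤ lookup β j)

  H⁺ : V → Pred W 0ℓ
  H⁺ β w = w · β ∈ Φ⁺

  Convex : Pred W 0ℓ → Set₁
  Convex L = ∃[ X ] X ⊆ Φ × L ≐ (λ w → ∀ β → β ∈ X → w ∈ H⁺ β)

  R : Pred W 0ℓ → Pred V 0ℓ
  R L β = β ∈ Φ × L ⊆ H⁺ β

------------------------------------------------------------------------
-- The words acting by products of reflections define an action of W.

module ActionProperties {n : ℕ} (M : CoxeterMatrix n) (ra : RightAngled M) where

  open CoxeterGroup M
  open Presentation M using (≈-refl; ≈-sym; ≈-trans; ++-cong; relation)
  open RootSystem M ra
  open Sum ℤₚ.+-*-semiring
    using (sum-syntax; sum-cong-≗; sum-replicate-zero; ∑-distrib-+; *-distribˡ-sum)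

  ext : ∀ {β γ : V} → (∀ j → lookup β j ≡ lookup γ j) → β ≡ γ
  ext {β} {γ} eq =
    trans (sym (tabulate∘lookup β)) (trans (tabulate-cong eq) (tabulate∘lookup γ))

  lookup-reflect : ∀ i β j → lookup (reflect i β) j ≡
                   lookup β j - + 2 * B β (α i) * lookup (α i) j
  lookup-reflect i β j =
    trans (lookup-zipWith _-_ j β _) (cong (λ x → lookup β j - x) (lookup-map j _ (α i)))

  sum-α : ∀ {m} (i : Fin m) (f : Fin m → ℤ) →
          ∑[ j < m ] ((if does (i ≟ j) then 1ℤ else 0ℤ) * f j) ≡ f i
  sum-α {ℕ.suc m} zero    f =
    trans (cong₂ _+_ (ℤₚ.*-identityˡ (f zero)) (sum-zero m))
          (ℤₚ.+-identityʳ (f zero))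
    where
    sum-zero : ∀ k → ∑[ j < k ] 0ℤ ≡ 0ℤ
    sum-zero = sum-replicate-zero
  sum-α {ℕ.suc m} (suc i) f =
    trans (ℤₚ.+-identityˡ _) (sum-α i (λ j → f (suc j)))

  row : ∀ β i j → ∑[ k < n ] (lookup β j * lookup (α i) k * gram j k)
                  ≡ lookup β j * gram j i
  row β i j = begin
    ∑[ k < n ] (b * lookup (α i) k * gram j k)
      ≡⟨ sum-cong-≗ (λ k → trans (cong (λ a → b * a * gram j k) (lookup∘tabulate _ k))
                                 (swap b _ (gram j k))) ⟩
    ∑[ k < n ] ((if does (i ≟ k) then 1ℤ else 0ℤ) * (b * gram j k))
      ≡⟨ sum-α i (λ k → b * gram j k) ⟩
    b * gram j i ∎
    where
    open ≡-Reasoning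
    b = lookup β j
    swap : ∀ x y z → x * y * z ≡ y * (x * z)
    swap = solve-∀

  B-α : ∀ β i → B β (α i) ≡ ∑[ j < n ] (lookup β j * gram j i)
  B-α β i = sum-cong-≗ (row β i)

  B-αα : ∀ i j → B (α i) (α j) ≡ gram i j
  B-αα i j = trans (B-α (α i) j)
    (trans (sum-cong-≗ (λ k → cong (_* gram k j) (lookup∘tabulate _ k)))
           (sum-α i (λ k → gram k j)))

  B-reflect : ∀ i β j → B (reflect i β) (α j) ≡ B β (α j) - + 2 * B β (α i) * gram i j
  B-reflect i β j = begin
    B (reflect i β) (α j)
      ≡⟨ B-α (reflect i β) j ⟩
    ∑[ k < n ] (lookup (reflect i β) k * gram k j)
      ≡⟨ sum-cong-≗ (λ k → trans (cong (_* gram k j) (lookup-reflect i β k))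
                                 (expand (lookup β k) c (lookup (α i) k) (gram k j))) ⟩
    ∑[ k < n ] (lookup β k * gram k j + - c * (lookup (α i) k * gram k j))
      ≡⟨ ∑-distrib-+ {n} _ _ ⟩
    ∑[ k < n ] (lookup β k * gram k j) +
    ∑[ k < n ] (- c * (lookup (α i) k * gram k j))
      ≡⟨ cong₂ _+_ (sym (B-α β j)) (sym (*-distribˡ-sum {n} (- c) _)) ⟩
    B β (α j) + - c * ∑[ k < n ] (lookup (α i) k * gram k j)
      ≡⟨ cong (λ x → B β (α j) + - c * x) (trans (sym (B-α (α i) j)) (B-αα i j)) ⟩
    B β (α j) + - c * gram i j
      ≡⟨ cong (λ x → B β (α j) + x) (sym (ℤₚ.neg-distribˡ-* c (gram i j))) ⟩
    B β (α j) - c * gram i j ∎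
    where
    open ≡-Reasoning
    c = + 2 * B β (α i)
    expand : ∀ b c a g → (b - c * a) * g ≡ b * g + - c * (a * g)
    expand = solve-∀

  gram-diagonal : ∀ i → gram i i ≡ 1ℤ
  gram-diagonal i with i ≟ i
  ... | yes _  = refl
  ... | no i≢i = contradiction refl i≢i

  gram-2 : ∀ i j → CoxeterMatrix.m M i j ≡ just 2 → gram i j ≡ 0ℤ
  gram-2 i j eq with i ≟ j
  ... | yes refl with () ← trans (sym eq) (CoxeterMatrix.diagonal M i)
  ... | no i≢j with ra i≢j
  ...   | inj₁ _ = refl
  ...   | inj₂ eq′ with () ← trans (sym eq) eq′

  reflect-involutive : ∀ i β → reflect i (reflect i β) ≡ β
  reflect-involutive i β = ext λ j → begin
    lookup (reflect i (reflect i β)) j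
      ≡⟨ lookup-reflect i (reflect i β) j ⟩
    lookup (reflect i β) j - + 2 * B (reflect i β) (α i) * lookup (α i) j
      ≡⟨ cong₂ (λ x y → x - + 2 * y * lookup (α i) j)
           (lookup-reflect i β j)
           (trans (B-reflect i β i)
                  (cong (λ g → B β (α i) - + 2 * B β (α i) * g) (gram-diagonal i))) ⟩
    _
      ≡⟨ cancel (lookup β j) (B β (α i)) (lookup (α i) j) ⟩
    lookup β j ∎
    where
    open ≡-Reasoning
    cancel : ∀ x b a → x - + 2 * b * a
                         - + 2 * (b - + 2 * b * 1ℤ) * a ≡ x
    cancel = solve-∀

  reflect² : ∀ i j → gram j i ≡ 0ℤ → ∀ β k → lookup (reflect i (reflect j β)) k ≡
    lookup β k - + 2 * B β (α j) * lookup (α j) k - + 2 * B β (α i) * lookup (α i) k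
  reflect² i j g≡0 β k = trans (lookup-reflect i (reflect j β) k)
    (cong₂ (λ x y → x - + 2 * y * lookup (α i) k)
       (lookup-reflect j β k)
       (trans (B-reflect j β i)
       (trans (cong (λ g → B β (α i) - + 2 * B β (α j) * g) g≡0)
              (simplify (B β (α i)) (B β (α j))))))
    where
    simplify : ∀ x y → x - + 2 * y * 0ℤ ≡ x
    simplify = solve-∀

  reflect-commute : ∀ i j → CoxeterMatrix.m M i j ≡ just 2 →
                    ∀ β → reflect i (reflect j β) ≡ reflect j (reflect i β)
  reflect-commute i j eq β = ext λ k →
    trans (reflect² i j (gram-2 j i (trans (CoxeterMatrix.symm M j i) eq)) β k)
    (trans (swap (lookup β k) _ _)
           (sym (reflect² j i (gram-2 i j eq) β k)))
    where
    swap : ∀ x y z → x - y - z ≡ x - z - y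
    swap = solve-∀

  finite-order : ∀ i j {k} → CoxeterMatrix.m M i j ≡ just k →
                 (i ≡ j × k ≡ 1) ⊎ (CoxeterMatrix.m M i j ≡ just 2 × k ≡ 2)
  finite-order i j eq with i ≟ j
  ... | yes refl =
    inj₁ (refl , just-injective (trans (sym eq) (CoxeterMatrix.diagonal M i)))
  ... | no i≢j with ra i≢j
  ...   | inj₁ eq′ = inj₂ (eq′ , just-injective (trans (sym eq) eq′))
  ...   | inj₂ eq′ with () ← trans (sym eq) eq′

  relation-· : ∀ i j {k} → CoxeterMatrix.m M i j ≡ just k →
               ∀ β → concat (replicate k (i ∷ j ∷ [])) · β ≡ β
  relation-· i j {k} eq β = cases (finite-order i j eq)
    where
    cases : (i ≡ j × k ≡ 1) ⊎ (CoxeterMatrix.m M i j ≡ just 2 × k ≡ 2) →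
            concat (replicate k (i ∷ j ∷ [])) · β ≡ β
    cases (inj₁ (refl , refl)) = reflect-involutive i β
    cases (inj₂ (eq′ , refl))  =
      trans (cong (λ γ → reflect i (reflect j γ)) (reflect-commute i j eq′ β))
      (trans (cong (reflect i) (reflect-involutive j (reflect i β)))
             (reflect-involutive i β))

  ∙-· : ∀ u v β → (u ∙ v) · β ≡ u · v · β
  ∙-· u v β = foldr-++ reflect β u v

  ·-congˡ : ∀ {u v} → u ≈ v → ∀ β → u · β ≡ v · β
  ·-congˡ ≈-refl           β = refl
  ·-congˡ (≈-sym p)        β = sym (·-congˡ p β)
  ·-congˡ (≈-trans p q)    β = trans (·-congˡ p β) (·-congˡ q β)
  ·-congˡ (++-cong {u} {u′} {v} {v′} p q) β =
    trans (∙-· u v β)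
    (trans (cong (u ·_) (·-congˡ q β))
    (trans (·-congˡ p (v′ · β)) (sym (∙-· u′ v′ β))))
  ·-congˡ (relation i j e) β = relation-· i j e β

------------------------------------------------------------------------
-- A toggle is defined by cases on membership in R L, which is undecidable
-- for a general convex set L; hence the parameter `em`.

module Billiards (em : ExcludedMiddle 0ℓ)
                 {n : ℕ} (M : CoxeterMatrix n) (ra : RightAngled M) where

  open CoxeterGroup M
  open RootSystem M ra

  τ : Pred W 0ℓ → Fin n → W → W
  τ L i u = if does (em {u ⁻¹ · α i ∈ R L}) then u else s i ∙ u

  -- The list i₁ ∷ … ∷ iₙ ∷ [].
  IsOrdering : List (Fin n) → Set
  IsOrdering is = is ↭ allFin n

  -- sᵢₙ ⋯ sᵢ₁
  orderedProduct : List (Fin n) → W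
  orderedProduct = foldl (λ w i → s i ∙ w) ε

  -- τᵢₙ ∘ ⋯ ∘ τᵢ₁
  Pro : Pred W 0ℓ → List (Fin n) → W → W
  Pro L is u = foldl (λ v i → τ L i v) u is

  IsCoxeterElement : W → Set
  IsCoxeterElement c = ∃[ is ] IsOrdering is × c ≈ orderedProduct is

  -- The map Pro_c is Pro L is for any ordering `is` representing c; it does
  -- not depend on the one chosen, so all of them may be quantified over.
  SuperheavyWrt : W → Pred W 0ℓ → Set
  SuperheavyWrt c L = ∀ is → IsOrdering is → c ≈ orderedProduct is →
                      ∀ u → ∃[ K ] (Pro L is ^ K) u ∈ L
    where open Endo W using (_^_)

  Superfuturistic : Set₁
  Superfuturistic = ∀ L → Convex L → Satisfiable L →
                    ∀ c → IsCoxeterElement c → SuperheavyWrt c L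

{-# OPTIONS --safe #-}
module Submission where

-- For β ∈ R L with u β negative, put γ = - u β, a positive root. In the
-- right-angled case B takes integer values on roots, so the walls of γ and αᵢ
-- coincide, are orthogonal, or are disjoint. If B(γ,αᵢ) < 0 then L lies on the side of
-- the αᵢ-wall containing u, so τᵢ fixes u; if B(γ,αᵢ) = 0 then sᵢ fixes γ; if
-- B(γ,αᵢ) > 0 then L lies beyond the αᵢ-wall, so τᵢ crosses it and the depth
-- of γ drops. Since B(γ,αᵢ) > 0 for some i, every application of Pro lowers
-- the depth of γ until u β is positive, and it stays positive from then on. The
-- depth of γ is initially less than the length of u x⁻¹ for any x ∈ L, so
-- one exponent works for all β at once.
--
-- The facts about roots come from one invariant: if γ is reached from a
-- simple root by ascending reflections, then B(γ, αₖ + αₗ) ≤ 0 whenever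
-- m(k,l) = ∞.

open import Defs
open import Axiom.ExcludedMiddle using (ExcludedMiddle)
open import Data.Nat.Base using (ℕ)
open import Level using (0ℓ)

open import Algebra.Bundles using (Group)
import Algebra.Properties.Semiring.Sum as Sum
open import Data.Bool.Base using (if_then_else_)
open import Data.Fin.Properties using (_≟_)
open import Data.Integer.Base
  using (+_; _+_; _-_; -_; _*_; 0ℤ; 1ℤ; -1ℤ; _≤_; _<_; +≤+; +<+; -≤+; nonNegative)
import Data.Integer.Properties as ℤₚ
open import Data.Integer.Tactic.RingSolver using (solve-∀)
open import Data.List.Base using ([]; _∷_; length)
import Data.List.Membership.Propositional as List
open import Data.List.Membership.Propositional.Properties using (∈-allFin)
open import Data.List.Relation.Binary.Permutation.Propositional using (↭-sym)
open import Data.List.Relation.Binary.Permutation.Propositional.Properties using (∈-resp-↭)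
open import Data.List.Relation.Unary.Any using (here; there)
open import Data.Maybe.Base using (just)
import Data.Nat.Base as ℕ
import Data.Nat.Properties as ℕₚ
open import Data.Product.Base using (_×_; _,_; ∃-syntax; proj₂)
open import Data.Sum.Base using (_⊎_; inj₁; inj₂)
open import Data.Vec.Base as Vec using (lookup; zipWith)
open import Data.Vec.Properties using (lookup-zipWith; lookup-map; lookup∘tabulate)
import Function.Endo.Propositional as Endo
open import Relation.Binary.Definitions using (tri<; tri≈; tri>)
open import Relation.Binary.PropositionalEquality
  using (_≡_; refl; sym; trans; cong; cong₂; subst; module ≡-Reasoning)
open import Relation.Nullary using (¬_; yes; no; does; contradiction)
open import Relation.Unary using (Pred; _∈_)

-- Integer inequalities for the coefficients of a reflection.

private
  0≤-* : ∀ {p q} → 0ℤ ≤ p → 0ℤ ≤ q → 0ℤ ≤ p * q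
  0≤-* {p} {q} 0≤p 0≤q =
    subst (_≤ p * q) (ℤₚ.*-zeroʳ p) (ℤₚ.*-monoˡ-≤-nonNeg p {{nonNegative 0≤p}} 0≤q)

  ≤-minus : ∀ x {p q} → p < 0ℤ → 0ℤ ≤ q → x ≤ x - + 2 * p * q
  ≤-minus x {p} {q} p<0 0≤q = ℤₚ.0≤i-j⇒j≤i (subst (0ℤ ≤_) (rearrange x p q)
    (0≤-* {+ 2} (+≤+ ℕ.z≤n) (0≤-* (ℤₚ.<⇒≤ (ℤₚ.neg-mono-< p<0)) 0≤q)))
    where
    rearrange : ∀ x p q → + 2 * (- p * q) ≡ x - + 2 * p * q - x
    rearrange = solve-∀

  minus-≤ : ∀ x {p q} → p < 0ℤ → q ≤ 0ℤ → x - + 2 * p * q ≤ x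
  minus-≤ x {p} {q} p<0 q≤0 = ℤₚ.0≤i-j⇒j≤i (subst (0ℤ ≤_) (rearrange x p q)
    (0≤-* {+ 2} (+≤+ ℕ.z≤n)
          (0≤-* (ℤₚ.<⇒≤ (ℤₚ.neg-mono-< p<0)) (ℤₚ.neg-mono-≤ q≤0))))
    where
    rearrange : ∀ x p q → + 2 * (- p * - q) ≡ x - (x - + 2 * p * q)
    rearrange = solve-∀

module Roots {n : ℕ} (M : CoxeterMatrix n) (ra : RightAngled M) where

  open CoxeterMatrix M
  open CoxeterGroup M
  open RootSystem M ra
  open ActionProperties M ra
  open Sum ℤₚ.+-*-semiring using (sum-syntax; sum-cong-≗; ∑-distrib-+; *-distribˡ-sum)

  -- The possible entries of the Gram matrix.

  link : ∀ i j → i ≡ j ⊎ m i j ≡ just 2 ⊎ gram i j ≡ -1ℤ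
  link i j with i ≟ j
  ... | yes i≡j = inj₁ i≡j
  ... | no i≢j with ra i≢j
  ...   | inj₁ eq = inj₂ (inj₁ eq)
  ...   | inj₂ _  = inj₂ (inj₂ refl)

  gram-free-sym : ∀ i j → gram i j ≡ -1ℤ → gram j i ≡ -1ℤ
  gram-free-sym i j free with link j i
  ... | inj₁ refl        = free
  ... | inj₂ (inj₁ eq)
    with () ← trans (sym free) (gram-2 i j (trans (symm i j) eq))
  ... | inj₂ (inj₂ free′) = free′

  gram≤0⊎≡ : ∀ i j → gram i j ≤ 0ℤ ⊎ i ≡ j
  gram≤0⊎≡ i j with link i j
  ... | inj₁ i≡j          = inj₂ i≡j
  ... | inj₂ (inj₁ eq)    = inj₁ (ℤₚ.≤-reflexive (gram-2 i j eq))
  ... | inj₂ (inj₂ free)  = inj₁ (subst (_≤ 0ℤ) (sym free) -≤+)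

  -- If `l` is `a` or `b`, the entries are 1 and -1 and cancel; otherwise neither is positive. This
  -- gives both the start and the inductive step of the invariant `FreePairs`.
  gram-free-+ : ∀ l a b → gram a b ≡ -1ℤ → gram l a + gram l b ≤ 0ℤ
  gram-free-+ l a b free with gram≤0⊎≡ l a | gram≤0⊎≡ l b
  ... | inj₁ la≤0 | inj₁ lb≤0 = ℤₚ.+-mono-≤ la≤0 lb≤0
  ... | inj₂ refl | _ = ℤₚ.≤-reflexive (cong₂ _+_ (gram-diagonal a) free)
  ... | inj₁ _ | inj₂ refl =
    ℤₚ.≤-reflexive (cong₂ _+_ (gram-free-sym a b free) (gram-diagonal b))

  -- Linearity of `B` and of the action.

  infixl 6 _⊕_
  infix  8 ⊖_

  _⊕_ : V → V → V
  _⊕_ = zipWith _+_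

  ⊖_ : V → V
  ⊖_ = Vec.map (-_)

  lookup-⊕ : ∀ β γ j → lookup (β ⊕ γ) j ≡ lookup β j + lookup γ j
  lookup-⊕ β γ j = lookup-zipWith _+_ j β γ

  lookup-⊖ : ∀ β j → lookup (⊖ β) j ≡ - lookup β j
  lookup-⊖ β j = lookup-map j (-_) β

  ⊖-involutive : ∀ β → ⊖ ⊖ β ≡ β
  ⊖-involutive β = ext λ j →
    trans (lookup-⊖ (⊖ β) j) (trans (cong (-_) (lookup-⊖ β j)) (ℤₚ.neg-involutive _))

  B-⊕ : ∀ β γ i → B (β ⊕ γ) (α i) ≡ B β (α i) + B γ (α i)
  B-⊕ β γ i = begin
    B (β ⊕ γ) (α i)
      ≡⟨ B-α (β ⊕ γ) i ⟩
    ∑[ j < n ] (lookup (β ⊕ γ) j * gram j i)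
      ≡⟨ sum-cong-≗ (λ j → trans (cong (_* gram j i) (lookup-⊕ β γ j))
                                 (ℤₚ.*-distribʳ-+ (gram j i) (lookup β j) (lookup γ j))) ⟩
    ∑[ j < n ] (lookup β j * gram j i + lookup γ j * gram j i)
      ≡⟨ ∑-distrib-+ {n} _ _ ⟩
    ∑[ j < n ] (lookup β j * gram j i) + ∑[ j < n ] (lookup γ j * gram j i)
      ≡⟨ cong₂ _+_ (sym (B-α β i)) (sym (B-α γ i)) ⟩
    B β (α i) + B γ (α i) ∎
    where open ≡-Reasoning

  B-⊖ : ∀ β i → B (⊖ β) (α i) ≡ - B β (α i)
  B-⊖ β i = begin
    B (⊖ β) (α i)
      ≡⟨ B-α (⊖ β) i ⟩
    ∑[ j < n ] (lookup (⊖ β) j * gram j i)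
      ≡⟨ sum-cong-≗ (λ j → trans (cong (_* gram j i) (lookup-⊖ β j))
                                 (negate (lookup β j) (gram j i))) ⟩
    ∑[ j < n ] (-1ℤ * (lookup β j * gram j i))
      ≡⟨ sym (*-distribˡ-sum {n} -1ℤ _) ⟩
    -1ℤ * ∑[ j < n ] (lookup β j * gram j i)
      ≡⟨ cong (-1ℤ *_) (sym (B-α β i)) ⟩
    -1ℤ * B β (α i)
      ≡⟨ ℤₚ.-1*i≡-i _ ⟩
    - B β (α i) ∎
    where
    open ≡-Reasoning
    negate : ∀ x y → - x * y ≡ -1ℤ * (x * y)
    negate = solve-∀

  reflect-⊕ : ∀ i β γ → reflect i (β ⊕ γ) ≡ reflect i β ⊕ reflect i γ
  reflect-⊕ i β γ = ext λ j → begin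
    lookup (reflect i (β ⊕ γ)) j
      ≡⟨ lookup-reflect i (β ⊕ γ) j ⟩
    lookup (β ⊕ γ) j - + 2 * B (β ⊕ γ) (α i) * lookup (α i) j
      ≡⟨ cong₂ (λ x y → x - + 2 * y * lookup (α i) j) (lookup-⊕ β γ j) (B-⊕ β γ i) ⟩
    lookup β j + lookup γ j - + 2 * (B β (α i) + B γ (α i)) * lookup (α i) j
      ≡⟨ rearrange (lookup β j) (lookup γ j) (B β (α i)) (B γ (α i)) (lookup (α i) j) ⟩
    (lookup β j - + 2 * B β (α i) * lookup (α i) j) +
    (lookup γ j - + 2 * B γ (α i) * lookup (α i) j)
      ≡⟨ sym (cong₂ _+_ (lookup-reflect i β j) (lookup-reflect i γ j)) ⟩
    lookup (reflect i β) j + lookup (reflect i γ) j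
      ≡⟨ sym (lookup-⊕ (reflect i β) (reflect i γ) j) ⟩
    lookup (reflect i β ⊕ reflect i γ) j ∎
    where
    open ≡-Reasoning
    rearrange : ∀ x y b c a → x + y - + 2 * (b + c) * a ≡
                              (x - + 2 * b * a) + (y - + 2 * c * a)
    rearrange = solve-∀

  reflect-⊖ : ∀ i β → reflect i (⊖ β) ≡ ⊖ reflect i β
  reflect-⊖ i β = ext λ j → begin
    lookup (reflect i (⊖ β)) j
      ≡⟨ lookup-reflect i (⊖ β) j ⟩
    lookup (⊖ β) j - + 2 * B (⊖ β) (α i) * lookup (α i) j
      ≡⟨ cong₂ (λ x y → x - + 2 * y * lookup (α i) j) (lookup-⊖ β j) (B-⊖ β i) ⟩
    - lookup β j - + 2 * - B β (α i) * lookup (α i) j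
      ≡⟨ rearrange (lookup β j) (B β (α i)) (lookup (α i) j) ⟩
    - (lookup β j - + 2 * B β (α i) * lookup (α i) j)
      ≡⟨ cong (-_) (sym (lookup-reflect i β j)) ⟩
    - lookup (reflect i β) j
      ≡⟨ sym (lookup-⊖ (reflect i β) j) ⟩
    lookup (⊖ reflect i β) j ∎
    where
    open ≡-Reasoning
    rearrange : ∀ x b a → - x - + 2 * - b * a ≡ - (x - + 2 * b * a)
    rearrange = solve-∀

  ·-⊕ : ∀ w β γ → w · (β ⊕ γ) ≡ w · β ⊕ w · γ
  ·-⊕ []      β γ = refl
  ·-⊕ (i ∷ w) β γ = trans (cong (reflect i) (·-⊕ w β γ)) (reflect-⊕ i (w · β) (w · γ))

  ·-⊖ : ∀ w β → w · (⊖ β) ≡ ⊖ (w · β)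
  ·-⊖ []      β = refl
  ·-⊖ (i ∷ w) β = trans (cong (reflect i) (·-⊖ w β)) (reflect-⊖ i (w · β))

  -- Simple reflections and their effect on `B`.

  reflect-α : ∀ i → reflect i (α i) ≡ ⊖ α i
  reflect-α i = ext λ j → trans (lookup-reflect i (α i) j)
    (trans (cong (λ b → lookup (α i) j - + 2 * b * lookup (α i) j)
                 (trans (B-αα i i) (gram-diagonal i)))
    (trans (simplify (lookup (α i) j)) (sym (lookup-⊖ (α i) j))))
    where
    simplify : ∀ x → x - + 2 * 1ℤ * x ≡ - x
    simplify = solve-∀

  reflect-orthogonal : ∀ i β → B β (α i) ≡ 0ℤ → reflect i β ≡ β
  reflect-orthogonal i β eq = ext λ j → trans (lookup-reflect i β j)
    (trans (cong (λ b → lookup β j - + 2 * b * lookup (α i) j) eq)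
           (simplify (lookup β j) (lookup (α i) j)))
    where
    simplify : ∀ x a → x - + 2 * 0ℤ * a ≡ x
    simplify = solve-∀

  B-reflect-self : ∀ i β → B (reflect i β) (α i) ≡ - B β (α i)
  B-reflect-self i β = trans (B-reflect i β i)
    (trans (cong (λ g → B β (α i) - + 2 * B β (α i) * g) (gram-diagonal i))
           (simplify (B β (α i))))
    where
    simplify : ∀ b → b - + 2 * b * 1ℤ ≡ - b
    simplify = solve-∀

  B-reflect-commuting : ∀ i j β → m i j ≡ just 2 → B (reflect i β) (α j) ≡ B β (α j)
  B-reflect-commuting i j β eq = trans (B-reflect i β j)
    (trans (cong (λ g → B β (α j) - + 2 * B β (α i) * g) (gram-2 i j eq))
           (simplify (B β (α j)) (B β (α i))))
    where
    simplify : ∀ x b → x - + 2 * b * 0ℤ ≡ x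
    simplify = solve-∀

  B-reflect-free : ∀ i j β → gram i j ≡ -1ℤ →
                   B (reflect i β) (α j) ≡ (B β (α i) + B β (α j)) + B β (α i)
  B-reflect-free i j β eq = trans (B-reflect i β j)
    (trans (cong (λ g → B β (α j) - + 2 * B β (α i) * g) eq)
           (simplify (B β (α i)) (B β (α j))))
    where
    simplify : ∀ b x → x - + 2 * b * -1ℤ ≡ (b + x) + b
    simplify = solve-∀

  -- Ascending chains of reflections.

  -- The start `b` is kept general because chains from a simple root and chains from a sum of two
  -- simple roots are both needed.
  data Ascent (b : V) : ℕ → V → Set where
    base : Ascent b 0 b
    step : ∀ {d γ} l → Ascent b d γ → B γ (α l) < 0ℤ → Ascent b (ℕ.suc d) (reflect l γ)

  -- gram k l ≡ -1ℤ expresses m(k,l) = ∞.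
  FreePairs : V → Set
  FreePairs γ = ∀ k l → gram k l ≡ -1ℤ → B γ (α k) + B γ (α l) ≤ 0ℤ

  -- A common weakening of being a simple root and being antidominant, so that one proof of
  -- `descend` serves both kinds of start.
  Antidominant⊎Simple : V → Set
  Antidominant⊎Simple β = ∀ k → B β (α k) ≤ 0ℤ ⊎ β ≡ α k

  α-antidominant⊎simple : ∀ i → Antidominant⊎Simple (α i)
  α-antidominant⊎simple i k with gram≤0⊎≡ i k
  ... | inj₁ g≤0  = inj₁ (subst (_≤ 0ℤ) (sym (B-αα i k)) g≤0)
  ... | inj₂ refl = inj₂ refl

  freePairs-α : ∀ i → FreePairs (α i)
  freePairs-α i k l free =
    subst (_≤ 0ℤ) (sym (cong₂ _+_ (B-αα i k) (B-αα i l))) (gram-free-+ i k l free)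

  freePairs-⊕ : ∀ β γ → FreePairs β → FreePairs γ → FreePairs (β ⊕ γ)
  freePairs-⊕ β γ fβ fγ k l free =
    subst (_≤ 0ℤ) (sym (trans (cong₂ _+_ (B-⊕ β γ k) (B-⊕ β γ l))
                              (interchange (B β (α k)) (B γ (α k)) (B β (α l)) (B γ (α l)))))
          (ℤₚ.+-mono-≤ (fβ k l free) (fγ k l free))
    where
    interchange : ∀ a b c d → (a + b) + (c + d) ≡ (a + c) + (b + d)
    interchange = solve-∀

  0≤α : ∀ i j → 0ℤ ≤ lookup (α i) j
  0≤α i j = subst (0ℤ ≤_) (sym (lookup∘tabulate _ j)) bit
    where
    bit : 0ℤ ≤ (if does (i ≟ j) then 1ℤ else 0ℤ)
    bit with i ≟ j
    ... | yes _ = +≤+ ℕ.z≤n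
    ... | no _  = +≤+ ℕ.z≤n

  α-diagonal : ∀ i → lookup (α i) i ≡ 1ℤ
  α-diagonal i = trans (lookup∘tabulate _ i) bit
    where
    bit : (if does (i ≟ i) then 1ℤ else 0ℤ) ≡ 1ℤ
    bit with i ≟ i
    ... | yes _  = refl
    ... | no i≢i = contradiction refl i≢i

  ascent-≥ : ∀ {b d γ} → Ascent b d γ → ∀ j → lookup b j ≤ lookup γ j
  ascent-≥ base j = ℤₚ.≤-refl
  ascent-≥ (step {γ = γ} l A B<0) j = ℤₚ.≤-trans (ascent-≥ A j)
    (subst (lookup γ j ≤_) (sym (lookup-reflect l γ j))
           (≤-minus (lookup γ j) B<0 (0≤α l j)))

  -- A step along `l` changes the sum by `-2 B(γ, α l)` times a sum of two Gram entries. The first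
  -- factor is positive and, by `gram-free-+`, the second is not.
  ascent-freePairs : ∀ {b d γ} → FreePairs b → Ascent b d γ → FreePairs γ
  ascent-freePairs f base = f
  ascent-freePairs f (step {γ = γ} l A B<0) k k′ free =
    ℤₚ.≤-trans
      (subst (_≤ B γ (α k) + B γ (α k′))
             (sym (trans (cong₂ _+_ (B-reflect l γ k) (B-reflect l γ k′))
                         (collect (B γ (α k)) (B γ (α k′)) (B γ (α l)) (gram l k) (gram l k′))))
             (minus-≤ _ B<0 (gram-free-+ l k k′ free)))
      (ascent-freePairs f A k k′ free)
    where
    collect : ∀ x y p g h → (x - + 2 * p * g) + (y - + 2 * p * h) ≡
                            (x + y) - + 2 * p * (g + h)
    collect = solve-∀

  -- In the case m(k,l) = ∞ the inequality defining FreePairs excludes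
  -- B γ (α k) > 0 for γ obtained by an ascent along l.
  descend : ∀ {b d γ} → FreePairs b → Antidominant⊎Simple b → Ascent b (ℕ.suc d) γ →
            ∀ k → 0ℤ < B γ (α k) → Ascent b d (reflect k γ)
  descend {b} {d} f a (step {γ = δ} l A B<0) k 0<B with link l k
  ... | inj₁ refl = subst (Ascent b d) (sym (reflect-involutive l δ)) A
  ... | inj₂ (inj₂ free) = contradiction
    (ℤₚ.<-≤-trans (subst (0ℤ <_) (B-reflect-free l k δ free) 0<B)
      (ℤₚ.+-mono-≤ (ascent-freePairs f A l k free) (ℤₚ.<⇒≤ B<0)))
    (ℤₚ.<-irrefl refl)
  -- Since `k` and `l` commute, already `B(b, α k) > 0`, which forces `b` to be `α k`. But then
  -- `B(b, α l)` is 0 and no ascent along `l` exists.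
  descend {b} {ℕ.zero} f a (step l base B<0) k 0<B | inj₂ (inj₁ lk) with a k
  ... | inj₁ B≤0  =
    contradiction B≤0 (ℤₚ.<⇒≱ (subst (0ℤ <_) (B-reflect-commuting l k b lk) 0<B))
  ... | inj₂ refl =
    contradiction B<0 (ℤₚ.<-irrefl (trans (B-αα k l) (gram-2 k l (trans (symm k l) lk))))
  -- The descent along `k` is performed before the last step, by induction, and the step along the
  -- commuting `l` is then redone.
  descend {b} {ℕ.suc d} f a (step {γ = δ} l A B<0) k 0<B | inj₂ (inj₁ lk) =
    subst (Ascent b (ℕ.suc d)) (reflect-commute l k lk δ)
      (step l (descend f a A k (subst (0ℤ <_) (B-reflect-commuting l k δ lk) 0<B))
        (subst (_< 0ℤ) (sym (B-reflect-commuting k l δ (trans (symm k l) lk))) B<0))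

  -- Orbits of antidominant vectors.

  Antidominant : V → Set
  Antidominant β = ∀ k → B β (α k) ≤ 0ℤ

  -- A descent can always be absorbed by `descend`, because an antidominant start admits no descent
  -- of its own.
  reflect-antidominant : ∀ {b d γ} → FreePairs b → Antidominant b → Ascent b d γ →
                         ∀ k → ∃[ d′ ] Ascent b d′ (reflect k γ)
  reflect-antidominant {b} {d} {γ} f a A k with ℤₚ.<-cmp (B γ (α k)) 0ℤ
  ... | tri< B<0 _ _ = _ , step k A B<0
  ... | tri≈ _ B≡0 _ = d , subst (Ascent b d) (sym (reflect-orthogonal k γ B≡0)) A
  reflect-antidominant f a base k | tri> _ _ 0<B =
    contradiction (a k) (ℤₚ.<⇒≱ 0<B)
  reflect-antidominant f a A@(step _ _ _) k | tri> _ _ 0<B =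
    _ , descend f (λ k′ → inj₁ (a k′)) A k 0<B

  ·-antidominant : ∀ {b} → FreePairs b → Antidominant b →
                   ∀ w → ∃[ d ] Ascent b d (w · b)
  ·-antidominant f a []      = 0 , base
  ·-antidominant f a (i ∷ w) = reflect-antidominant f a (proj₂ (·-antidominant f a w)) i

  -- Positive and negative roots.

  Root : ℕ → V → Set
  Root d γ = ∃[ j ] Ascent (α j) d γ

  -- An inductive form of `Φ⁺`; the two agree by `Φ⁺⇒positive` and `positive⇒Φ⁺`.
  Positive : V → Set
  Positive ξ = ∃[ d ] Root d ξ

  Negative : V → Set
  Negative ξ = Positive (⊖ ξ)

  positive-α : ∀ i → Positive (α i)
  positive-α i = 0 , i , base

  reflect-root-< : ∀ {d γ} → Root d γ → ∀ k → B γ (α k) < 0ℤ →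
                   Root (ℕ.suc d) (reflect k γ)
  reflect-root-< (j , A) k B<0 = j , step k A B<0

  -- Distinct simple roots pair nonpositively, so a simple root descends only along itself; at
  -- positive depth `descend` applies. Hence a simple reflection makes no positive root negative
  -- except its own simple root.
  reflect-root-> : ∀ {d γ} → Root d γ → ∀ k → 0ℤ < B γ (α k) →
                   γ ≡ α k ⊎ ∃[ d′ ] d ≡ ℕ.suc d′ × Root d′ (reflect k γ)
  reflect-root-> (j , base) k 0<B with α-antidominant⊎simple j k
  ... | inj₁ B≤0 = contradiction B≤0 (ℤₚ.<⇒≱ 0<B)
  ... | inj₂ eq  = inj₁ eq
  reflect-root-> (j , A@(step _ _ _)) k 0<B =
    inj₂ (_ , refl , j , descend (freePairs-α j) (α-antidominant⊎simple j) A k 0<B)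

  -- Reversing the last ascent is a descent, and a simple root pairs to 1 with itself.
  root-descent : ∀ {d γ} → Root d γ → ∃[ i ] 0ℤ < B γ (α i)
  root-descent (j , base) =
    j , subst (0ℤ <_) (sym (trans (B-αα j j) (gram-diagonal j))) (+<+ (ℕ.s≤s ℕ.z≤n))
  root-descent (j , step {γ = γ} l A B<0) =
    l , subst (0ℤ <_) (sym (B-reflect-self l γ)) (ℤₚ.neg-mono-< B<0)

  positive-≥0 : ∀ {ξ} → Positive ξ → ∀ j → 0ℤ ≤ lookup ξ j
  positive-≥0 (_ , i , A) j = ℤₚ.≤-trans (0≤α i j) (ascent-≥ A j)

  positive-support : ∀ {ξ} → Positive ξ → ∃[ j ] 0ℤ < lookup ξ j
  positive-support (_ , i , A) =
    i , ℤₚ.<-≤-trans (subst (0ℤ <_) (sym (α-diagonal i)) (+<+ (ℕ.s≤s ℕ.z≤n))) (ascent-≥ A i)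

  nonneg⇒¬negative : ∀ {ξ} → (∀ j → 0ℤ ≤ lookup ξ j) → ¬ Negative ξ
  nonneg⇒¬negative {ξ} 0≤ξ N with positive-support N
  ... | j , 0<-ξ = ℤₚ.<-irrefl refl (ℤₚ.<-≤-trans (subst (0ℤ <_) (lookup-⊖ ξ j) 0<-ξ)
                                                  (ℤₚ.neg-mono-≤ (0≤ξ j)))

  positive⇒¬negative : ∀ {ξ} → Positive ξ → ¬ Negative ξ
  positive⇒¬negative P = nonneg⇒¬negative (positive-≥0 P)

  positive⇒Φ : ∀ {ξ} → Positive ξ → ξ ∈ Φ
  positive⇒Φ (_ , j , A) = let w , eq = word A in w , j , eq
    where
    word : ∀ {d γ} → Ascent (α j) d γ → ∃[ w ] γ ≡ w · α j
    word base         = [] , refl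
    word (step l A _) = let w , eq = word A in l ∷ w , cong (reflect l) eq

  -- Depth bounds and the sign dichotomy.

  -- The bound is strict, so `Below 0 ξ` leaves only the positive case: this is the target of the
  -- countdown.
  Below : ℕ → V → Set
  Below d ξ = Positive ξ ⊎ ∃[ d′ ] d′ ℕ.< d × Root d′ (⊖ ξ)

  below-weaken : ∀ {d d′ ξ} → d ℕ.≤ d′ → Below d ξ → Below d′ ξ
  below-weaken d≤d′ (inj₁ P)              = inj₁ P
  below-weaken d≤d′ (inj₂ (e , e<d , r)) = inj₂ (e , ℕₚ.<-≤-trans e<d d≤d′ , r)

  below⇒± : ∀ {d ξ} → Below d ξ → Positive ξ ⊎ Negative ξ
  below⇒± (inj₁ P)           = inj₁ P
  below⇒± (inj₂ (d , _ , r)) = inj₂ (d , r)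

  reflect-below : ∀ {d ξ} → Below d ξ → ∀ k → Below (ℕ.suc d) (reflect k ξ)
  reflect-below {d} {ξ} (inj₁ (e , r)) k with ℤₚ.<-cmp (B ξ (α k)) 0ℤ
  ... | tri< B<0 _ _ = inj₁ (_ , reflect-root-< r k B<0)
  ... | tri≈ _ B≡0 _ = inj₁ (e , subst (Root e) (sym (reflect-orthogonal k ξ B≡0)) r)
  ... | tri> _ _ 0<B with reflect-root-> r k 0<B
  ...   | inj₂ (e′ , _ , r′) = inj₁ (e′ , r′)
  -- The root `α k` becomes `- α k`, whose opposite has depth 0; this is the only change from
  -- positive to negative.
  ...   | inj₁ refl = inj₂ (0 , ℕ.s≤s ℕ.z≤n ,
    subst (Root 0) (sym (trans (cong ⊖_ (reflect-α k)) (⊖-involutive (α k)))) (k , base))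
  reflect-below {d} {ξ} (inj₂ (e , e<d , r)) k with ℤₚ.<-cmp (B (⊖ ξ) (α k)) 0ℤ
  ... | tri< B<0 _ _ =
    inj₂ (ℕ.suc e , ℕ.s≤s e<d ,
          subst (Root (ℕ.suc e)) (reflect-⊖ k ξ) (reflect-root-< r k B<0))
  ... | tri≈ _ B≡0 _ = inj₂ (e , ℕₚ.m<n⇒m<1+n e<d ,
    subst (Root e) (trans (sym (reflect-orthogonal k (⊖ ξ) B≡0)) (reflect-⊖ k ξ)) r)
  ... | tri> _ _ 0<B with reflect-root-> r k 0<B
  ...   | inj₂ (e′ , refl , r′) =
    inj₂ (e′ , ℕₚ.m<n⇒m<1+n (ℕₚ.<-trans (ℕₚ.n<1+n e′) e<d) ,
          subst (Root e′) (reflect-⊖ k ξ) r′)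
  ...   | inj₁ eq = inj₁ (subst Positive (sym reflected) (positive-α k))
    where
    reflected : reflect k ξ ≡ α k
    reflected = trans (sym (⊖-involutive (reflect k ξ)))
      (trans (cong ⊖_ (trans (sym (reflect-⊖ k ξ)) (trans (cong (reflect k) eq) (reflect-α k))))
             (⊖-involutive (α k)))

  ·-below : ∀ {ξ} → Positive ξ → ∀ w → Below (length w) (w · ξ)
  ·-below P []      = inj₁ P
  ·-below P (i ∷ w) = reflect-below (·-below P w) i

  ·-± : ∀ w i → Positive (w · α i) ⊎ Negative (w · α i)
  ·-± w i = below⇒± (·-below (positive-α i) w)

  Φ⁺⇒positive : ∀ {ξ} → ξ ∈ Φ⁺ → Positive ξ
  Φ⁺⇒positive ((w , i , refl) , 0≤ξ) with ·-± w i
  ... | inj₁ P = P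
  ... | inj₂ N = contradiction N (nonneg⇒¬negative 0≤ξ)

  positive⇒Φ⁺ : ∀ {ξ} → Positive ξ → ξ ∈ Φ⁺
  positive⇒Φ⁺ P = positive⇒Φ P , positive-≥0 P

  -- Relative position of two walls.

  α⊕α-antidominant : ∀ i j → gram i j ≡ -1ℤ → Antidominant (α i ⊕ α j)
  α⊕α-antidominant i j free k =
    subst (_≤ 0ℤ) (sym (trans (B-⊕ (α i) (α j) k) (cong₂ _+_ (B-αα i k) (B-αα j k)))) bound
    where
    bound : gram i k + gram j k ≤ 0ℤ
    bound with gram≤0⊎≡ i k | gram≤0⊎≡ j k
    ... | inj₁ p    | inj₁ q    = ℤₚ.+-mono-≤ p q
    ... | inj₂ refl | _         =
      ℤₚ.≤-reflexive (cong₂ _+_ (gram-diagonal i) (gram-free-sym i j free))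
    ... | inj₁ _    | inj₂ refl = ℤₚ.≤-reflexive (cong₂ _+_ free (gram-diagonal j))

  -- α i + α j is an antidominant vector, so its whole W-orbit is nonnegative.
  free-descents : ∀ i j → gram i j ≡ -1ℤ → ∀ w →
                  Negative (w · α i) → Positive (w · α j)
  free-descents i j free w Ni with ·-± w j
  ... | inj₁ P  = P
  ... | inj₂ Nj = contradiction Nj (nonneg⇒¬negative 0≤j)
    where
    orbit : ∃[ d ] Ascent (α i ⊕ α j) d (w · (α i ⊕ α j))
    orbit = ·-antidominant (freePairs-⊕ (α i) (α j) (freePairs-α i) (freePairs-α j))
                           (α⊕α-antidominant i j free) w
    0≤sum : ∀ k → 0ℤ ≤ lookup (w · α i) k + lookup (w · α j) k
    0≤sum k = subst (0ℤ ≤_)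
      (trans (cong (λ ξ → lookup ξ k) (·-⊕ w (α i) (α j))) (lookup-⊕ (w · α i) (w · α j) k))
      (ℤₚ.≤-trans (subst (0ℤ ≤_) (sym (lookup-⊕ (α i) (α j) k))
                         (ℤₚ.+-mono-≤ (0≤α i k) (0≤α j k)))
                  (ascent-≥ (proj₂ orbit) k))
    -- The vector `w · α j` is the nonnegative image of `α i ⊕ α j` plus the positive root
    -- `- (w · α i)`.
    0≤j : ∀ k → 0ℤ ≤ lookup (w · α j) k
    0≤j k = subst (0ℤ ≤_) (cancel (lookup (w · α i) k) (lookup (w · α j) k))
      (ℤₚ.+-mono-≤ (0≤sum k) (subst (0ℤ ≤_) (lookup-⊖ (w · α i) k) (positive-≥0 Ni k)))
      where
      cancel : ∀ x y → (x + y) + - x ≡ y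
      cancel = solve-∀

  ·-reflect : ∀ w l δ → (w ∙ s l) · reflect l δ ≡ w · δ
  ·-reflect w l δ = trans (∙-· w (s l) (reflect l δ)) (cong (w ·_) (reflect-involutive l δ))

  ·-s-α : ∀ w l → (w ∙ s l) · α l ≡ ⊖ (w · α l)
  ·-s-α w l = trans (∙-· w (s l) (α l)) (trans (cong (w ·_) (reflect-α l)) (·-⊖ w (α l)))

  reflect-α-commuting : ∀ l i → m l i ≡ just 2 → reflect l (α i) ≡ α i
  reflect-α-commuting l i eq =
    reflect-orthogonal l (α i) (trans (B-αα i l) (gram-2 i l (trans (symm i l) eq)))

  -- Induction on the ascent to `γ`, with `w` varying: the last reflection is moved from the root
  -- into the group element. A simple root with negative pairing must be free with `i`, which is the
  -- case of `free-descents`.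
  disjoint-walls : ∀ {d γ} → Root d γ → ∀ i → B γ (α i) < 0ℤ →
                   ∀ w → Negative (w · γ) → Positive (w · α i)
  disjoint-walls (j , base) i B<0 w N with link j i
  ... | inj₁ refl = contradiction
    (subst (_< 0ℤ) (trans (B-αα j j) (gram-diagonal j)) B<0) λ { (+<+ ()) }
  ... | inj₂ (inj₁ eq)   = contradiction B<0 (ℤₚ.<-irrefl (trans (B-αα j i) (gram-2 j i eq)))
  ... | inj₂ (inj₂ free) = free-descents j i free w N
  disjoint-walls (j , step {γ = δ} l A Bδ<0) i B<0 w N with link l i
  ... | inj₁ refl = contradiction
    (ℤₚ.<-trans (subst (_< 0ℤ) (B-reflect-self l δ) B<0) (ℤₚ.neg-mono-< Bδ<0))
    (ℤₚ.<-irrefl refl)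
  ... | inj₂ (inj₁ eq) = subst Positive
    (trans (∙-· w (s l) (α i)) (cong (w ·_) (reflect-α-commuting l i eq)))
    (disjoint-walls (j , A) i (subst (_< 0ℤ) (B-reflect-commuting l i δ eq) B<0) (w ∙ s l)
      (subst Negative (sym (∙-· w (s l) δ)) N))
  -- The induction hypothesis is used for `α l` in place of `α i`. It makes `(w ∙ s l) · α l`, which
  -- is `- (w · α l)`, positive.
  ... | inj₂ (inj₂ free) = free-descents l i free w
    (subst Positive (·-s-α w l)
      (disjoint-walls (j , A) l Bδ<0 (w ∙ s l)
        (subst Negative (sym (∙-· w (s l) δ)) N)))

  -- Reflecting `γ` in `α i` reverses the sign of the pairing, which reduces the claim to
  -- `disjoint-walls` for `w ∙ s i`.
  nested-walls : ∀ {d γ} → Root d γ → ∀ i → 0ℤ < B γ (α i) →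
                 ∀ w → Negative (w · γ) → Negative (w · α i)
  nested-walls {γ = γ} r i 0<B w N with reflect-root-> r i 0<B
  ... | inj₁ refl = N
  ... | inj₂ (_ , _ , r′) = subst Positive (·-s-α w i)
    (disjoint-walls r′ i
      (subst (_< 0ℤ) (sym (B-reflect-self i γ)) (ℤₚ.neg-mono-< 0<B)) (w ∙ s i)
      (subst Negative (sym (·-reflect w i γ)) N))

-- Effect of one toggle on a root of `R L`.

module Trajectory (em : ExcludedMiddle 0ℓ)
                  {n : ℕ} (M : CoxeterMatrix n) (ra : RightAngled M) where

  open CoxeterGroup M
  open Group (Presentation.group M) using (inverseˡ)
  open RootSystem M ra
  open ActionProperties M ra
  open Roots M ra
  open Billiards em M ra
  open Endo W using (_^_)

  τ-cases : ∀ L i u → (u ⁻¹ · α i ∈ R L × τ L i u ≡ u) ⊎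
                      (¬ (u ⁻¹ · α i ∈ R L) × τ L i u ≡ s i ∙ u)
  τ-cases L i u with em {u ⁻¹ · α i ∈ R L}
  ... | yes p = inj₁ (p , refl)
  ... | no ¬p = inj₂ (¬p , refl)

  ·-inverseˡ : ∀ u ξ → u ⁻¹ · u · ξ ≡ ξ
  ·-inverseˡ u ξ = trans (sym (∙-· (u ⁻¹) u ξ)) (·-congˡ (inverseˡ u) ξ)

  module _ (L : Pred W 0ℓ) {x : W} (x∈L : x ∈ L) {β : V} (β∈R : β ∈ R L) where

    -- The element `y ∙ u ⁻¹` sends `- u β` to `- y β`, and `y β` is positive for `y` in `L`. This
    -- is the hypothesis of the two wall lemmas.
    R-negative : ∀ y u → y ∈ L → Negative ((y ∙ u ⁻¹) · ⊖ (u · β))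
    R-negative y u y∈L = subst Positive (sym eq) (Φ⁺⇒positive (proj₂ β∈R y∈L))
      where
      eq : ⊖ ((y ∙ u ⁻¹) · ⊖ (u · β)) ≡ y · β
      eq = trans (cong ⊖_ (·-⊖ (y ∙ u ⁻¹) (u · β)))
        (trans (⊖-involutive _)
        (trans (∙-· y (u ⁻¹) (u · β)) (cong (y ·_) (·-inverseˡ u β))))

    blocked : ∀ i u {d} → Root d (⊖ (u · β)) → B (⊖ (u · β)) (α i) < 0ℤ →
              u ⁻¹ · α i ∈ R L
    blocked i u r B<0 = (u ⁻¹ , i , refl) , λ {y} y∈L →
      positive⇒Φ⁺ (subst Positive (∙-· y (u ⁻¹) (α i))
        (disjoint-walls r i B<0 (y ∙ u ⁻¹) (R-negative y u y∈L)))

    crossed : ∀ i u {d} → Root d (⊖ (u · β)) → 0ℤ < B (⊖ (u · β)) (α i) →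
              ¬ (u ⁻¹ · α i ∈ R L)
    crossed i u r 0<B (_ , L⊆H⁺) = positive⇒¬negative
      (Φ⁺⇒positive (L⊆H⁺ x∈L))
      (subst Negative (∙-· x (u ⁻¹) (α i))
        (nested-walls r i 0<B (x ∙ u ⁻¹) (R-negative x u x∈L)))

    -- The sign could be lost only if `u β` were `α i`. But then `u ⁻¹ · α i` is `β`, which lies in
    -- `R L`, so the toggle does not move `u`.
    τ-positive : ∀ i u → Positive (u · β) → Positive (τ L i u · β)
    τ-positive i u P@(d , r) with τ-cases L i u
    ... | inj₁ (_ , eq) = subst (λ v → Positive (v · β)) (sym eq) P
    ... | inj₂ (¬p , eq) = subst (λ v → Positive (v · β)) (sym eq)
      (positive (ℤₚ.<-cmp (B (u · β) (α i)) 0ℤ))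
      where
      positive : _ → Positive (reflect i (u · β))
      positive (tri< B<0 _ _) = _ , reflect-root-< r i B<0
      positive (tri≈ _ B≡0 _) = subst Positive (sym (reflect-orthogonal i (u · β) B≡0)) P
      positive (tri> _ _ 0<B) with reflect-root-> r i 0<B
      ... | inj₂ (d′ , _ , r′) = d′ , r′
      ... | inj₁ uβ≡α = contradiction
        (subst (_∈ R L) (trans (sym (·-inverseˡ u β)) (cong (u ⁻¹ ·_) uβ≡α)) β∈R) ¬p

    -- The first alternative also records that `i` is not a descent of `- u β`; `Pro-lower` needs
    -- this to conclude that a descent in the ordering is never passed without effect.
    τ-negative : ∀ {d} i u → Root d (⊖ (u · β)) →
                 (τ L i u · β ≡ u · β × ¬ (0ℤ < B (⊖ (u · β)) (α i))) ⊎
                 Below d (τ L i u · β)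
    τ-negative {d} i u r with ℤₚ.<-cmp (B (⊖ (u · β)) (α i)) 0ℤ | τ-cases L i u
    ... | tri< _ _ ¬0<B   | inj₁ (_ , eq) = inj₁ (cong (_· β) eq , ¬0<B)
    ... | tri< B<0 _ _    | inj₂ (¬p , _) = contradiction (blocked i u r B<0) ¬p
    ... | tri≈ _ _ ¬0<B   | inj₁ (_ , eq) = inj₁ (cong (_· β) eq , ¬0<B)
    ... | tri≈ _ B≡0 ¬0<B | inj₂ (_ , eq) = inj₁ (trans (cong (_· β) eq) fixed , ¬0<B)
      where
      fixed : reflect i (u · β) ≡ u · β
      fixed = trans (sym (⊖-involutive _))
        (trans (cong ⊖_ (trans (sym (reflect-⊖ i (u · β))) (reflect-orthogonal i _ B≡0)))
               (⊖-involutive _))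
    ... | tri> _ _ 0<B | inj₁ (p , _) = contradiction p (crossed i u r 0<B)
    ... | tri> _ _ 0<B | inj₂ (_ , eq) =
      inj₂ (subst (λ v → Below d (v · β)) (sym eq) (lower (reflect-root-> r i 0<B)))
      where
      lower : _ → Below d (reflect i (u · β))
      lower (inj₂ (d′ , refl , r′)) =
        inj₂ (d′ , ℕₚ.n<1+n d′ , subst (Root d′) (reflect-⊖ i (u · β)) r′)
      -- Here the depth cannot drop further: the toggle crosses the wall of `β` itself and the root
      -- becomes positive.
      lower (inj₁ ⊖uβ≡α) = inj₁ (subst Positive (sym reflected) (positive-α i))
        where
        reflected : reflect i (u · β) ≡ α i
        reflected = trans (cong (reflect i) (trans (sym (⊖-involutive _)) (cong ⊖_ ⊖uβ≡α)))
          (trans (reflect-⊖ i (α i)) (trans (cong ⊖_ (reflect-α i)) (⊖-involutive _)))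

    τ-below : ∀ {d} i u → Below d (u · β) → Below d (τ L i u · β)
    τ-below i u (inj₁ P) = inj₁ (τ-positive i u P)
    τ-below {d} i u (inj₂ (e , e<d , r)) with τ-negative i u r
    ... | inj₁ (eq , _) = inj₂ (e , e<d , subst (λ ξ → Root e (⊖ ξ)) (sym eq) r)
    ... | inj₂ b        = below-weaken (ℕₚ.<⇒≤ e<d) b

    -- Iterating `Pro`.

    Pro-below : ∀ {d} is u → Below d (u · β) → Below d (Pro L is u · β)
    Pro-below []       u b = b
    Pro-below (i ∷ is) u b = Pro-below is (τ L i u) (τ-below i u b)

    -- As long as no toggle lowers the depth, `u β` stays the same, so `i` is still a descent when
    -- its turn comes.
    Pro-lower : ∀ {d} is u → Root d (⊖ (u · β)) →
                ∀ {i} → i List.∈ is → 0ℤ < B (⊖ (u · β)) (α i) →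
                Below d (Pro L is u · β)
    Pro-lower (k ∷ is) u r i∈is 0<B with τ-negative k u r
    Pro-lower (k ∷ is) u r i∈is 0<B | inj₂ b = Pro-below is (τ L k u) b
    Pro-lower (k ∷ is) u r (here refl) 0<B | inj₁ (_ , ¬0<B) = contradiction 0<B ¬0<B
    Pro-lower {d} (k ∷ is) u r {i} (there i∈is) 0<B | inj₁ (eq , _) =
      Pro-lower is (τ L k u) (subst (λ ξ → Root d (⊖ ξ)) (sym eq) r) i∈is
                (subst (λ ξ → 0ℤ < B (⊖ ξ) (α i)) (sym eq) 0<B)

    round : ∀ {is} → IsOrdering is →
            ∀ {d} u → Below (ℕ.suc d) (u · β) → Below d (Pro L is u · β)
    round {is} ord u (inj₁ P) = Pro-below is u (inj₁ P)
    round {is} ord u (inj₂ (e , ℕ.s≤s e≤d , r)) with root-descent r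
    -- An ordering contains every index, in particular the descent `i`. The new depth is below `e`,
    -- hence below `d`.
    ... | i , 0<B = below-weaken e≤d
      (Pro-lower is u r (∈-resp-↭ (↭-sym ord) (∈-allFin i)) 0<B)

    rounds : ∀ {is} → IsOrdering is →
             ∀ K {d} u → Below (K ℕ.+ d) (u · β) → Below d ((Pro L is ^ K) u · β)
    rounds ord ℕ.zero    u b = b
    -- The power applies its last factor outermost, so the inner `K` rounds must end at `suc d`,
    -- leaving one unit for the final round.
    rounds {is} ord (ℕ.suc K) {d} u b = round ord ((Pro L is ^ K) u)
      (rounds ord K u (subst (λ e → Below e (u · β)) (sym (ℕₚ.+-suc K d)) b))

    arrival : ∀ {is} → IsOrdering is → ∀ u →
              (Pro L is ^ length (u ∙ x ⁻¹)) u ∈ H⁺ β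
    arrival {is} ord u with rounds ord (length (u ∙ x ⁻¹)) u
      -- The countdown runs with final bound 0. Its start comes from writing `u β` as `u ∙ x ⁻¹`
      -- applied to the positive root `x β`.
      (below-weaken (ℕₚ.≤-reflexive (sym (ℕₚ.+-identityʳ _)))
        (subst (Below (length (u ∙ x ⁻¹)))
               (trans (∙-· u (x ⁻¹) (x · β)) (cong (u ·_) (·-inverseˡ x β)))
               (·-below (Φ⁺⇒positive (proj₂ β∈R x∈L)) (u ∙ x ⁻¹))))
    ... | inj₁ P = positive⇒Φ⁺ P

theorem1p16 : (em : ExcludedMiddle 0ℓ) →
    (n : ℕ) (M : CoxeterMatrix n) (ra : RightAngled M) →
    Billiards.Superfuturistic em M ra
theorem1p16 em n M ra L (X , X⊆Φ , L⊆ , ⊆L) (x , x∈L) c _ is ord _ u =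
  -- The exponent is fixed before `β`. Each `β` in `X` belongs to `R L`, since `L` lies in all the
  -- half-spaces that define it.
  length (u ∙ x ⁻¹) , ⊆L λ β β∈X →
    arrival L x∈L (X⊆Φ β∈X , λ w∈L → L⊆ w∈L β β∈X) ord u
  where
  open CoxeterGroup M
  open Trajectory em M ra
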